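{- Consider the Downward-Closed Prophet problem in which every item value $X_i$ takes values in $\{0,1\}$. There is a deterministic online algorithm for this problem that achieves a competitive ratio of $O(\log n)$.
   Context: Downward-Closed Prophet: there are $n$ items with independently (not necessarily identically) distributed values $X_i\sim\mathcal{D}_i$, $i=1,\dots,n$. Let $\mathcal{F}$ be an arbitrary downward-closed family of subsets of $[n]$ (the feasible sets). The algorithm receives $n$, $\mathcal{F}$ and the distributions $\mathcal{D}_i$ as input, and observes the realizations of $X_1,X_2,\dots,X_n$ one at a time in this order. Starting from $W=\emptyset$, after observing $X_i$ the algorithm must decide immediately and irrevocably whether to add $i$ to $W$, subject to $W$ remaining in $\mathcal{F}$. The algorithm's value is $\sum_{i\in W}X_i$. The competitive ratio of an algorithm is the worst case, over all instances, of the ratio $\mathbb{E}[\max_{S\in\mathcal{F}}\sum_{i\in S}X_i]/\mathbb{E}[\sum_{i\in W}X_i]$.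
   Formalization: The probabilities with which the item values equal 1 are taken to be rational numbers in [0,1] instead of arbitrary real numbers. -}

module Defs where

open import Data.Bool using (Bool; true; false; if_then_else_; _∧_)
open import Data.Nat using (ℕ; zero; suc; _⊔_)
import Data.Nat as ℕ
open import Data.Nat.Logarithm using (⌊log₂_⌋)
open import Data.Integer using (+_)
open import Data.Fin using (Fin)
open import Data.Fin.Subset using (Subset; _⊆_; _∪_; ⁅_⁆; ⊥; inside; outside)
open import Data.Vec using (Vec; []; _∷_; lookup; toList)
open import Data.List using (List; []; _∷_; _++_; [_]; map; foldr; concatMap; allFin)
open import Data.Rational using (ℚ; 0ℚ; 1ℚ; _+_; _*_; _-_; _/_; _≤_)
open import Relation.Binary.PropositionalEquality using (_≡_)

Family : ℕ → Set
Family n = Subset n → Bool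

DownwardClosed : ∀ {n} → Family n → Set
DownwardClosed {n} F = (S T : Subset n) → S ⊆ T → F T ≡ true → F S ≡ true

-- An outcome: realization of the {0,1}-valued X_1..X_n (true = 1).
Outcome : ℕ → Set
Outcome n = Vec Bool n

allOutcomes : (n : ℕ) → List (Outcome n)
allOutcomes zero = [] ∷ []
allOutcomes (suc n) = concatMap (λ v → (false ∷ v) ∷ (true ∷ v) ∷ []) (allOutcomes n)

allSubsets : (n : ℕ) → List (Subset n)
allSubsets = allOutcomes

value : ∀ {n} → Outcome n → Subset n → ℕ
value [] [] = 0
value (x ∷ xs) (s ∷ ss) = (if x ∧ s then 1 else 0) ℕ.+ value xs ss

opt : ∀ {n} → Family n → Outcome n → ℕ
opt {n} F x = foldr (λ S m → if F S then value x S ⊔ m else m) 0 (allSubsets n)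

-- A deterministic online decision rule: given the history of observed values
-- X_1,...,X_i (the last entry being the current item i), decide whether to take i.
Strategy : Set
Strategy = List Bool → Bool

runFrom : ∀ {n} → Family n → Strategy → Outcome n → List (Fin n) → List Bool → Subset n → Subset n
runFrom F σ x [] h W = W
runFrom F σ x (i ∷ is) h W with h ++ [ lookup x i ]
... | h' = if σ h' ∧ F (W ∪ ⁅ i ⁆)
             then runFrom F σ x is h' (W ∪ ⁅ i ⁆)
             else runFrom F σ x is h' W

run : ∀ {n} → Family n → Strategy → Outcome n → Subset n
run {n} F σ x = runFrom F σ x (allFin n) [] ⊥

prob : ∀ {n} → Vec ℚ n → Outcome n → ℚ
prob [] [] = 1ℚ
prob (p ∷ ps) (x ∷ xs) = (if x then p else (1ℚ - p)) * prob ps xs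

toℚ : ℕ → ℚ
toℚ k = + k / 1

expect : ∀ {n} → Vec ℚ n → (Outcome n → ℕ) → ℚ
expect {n} p f = foldr (λ x acc → prob p x * toℚ (f x) + acc) 0ℚ (allOutcomes n)

ValidProbs : ∀ {n} → Vec ℚ n → Set
ValidProbs [] = Data.Unit.⊤ where import Data.Unit
ValidProbs (p ∷ ps) = (0ℚ ≤ p) Data.Product.× ((p ≤ 1ℚ) Data.Product.× ValidProbs ps)
  where import Data.Product

Algorithm : Set
Algorithm = (n : ℕ) → Family n → Vec ℚ n → Strategy

{-
Let V(F) be the value of the best online strategy, computed by dynamic programming, and let
Φ(F) = 𝔼 2 ^ opt F, where F \ 0 and F / 0 denote deletion and contraction of the first item, of
probability p. Conditioning on that item and using max (a , 1 + b) ≤ log₂ (2 ^ a + 2 · 2 ^ b) gives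
  Φ(F) ≤ (1 - p) Φ(F \ 0) + p min (2 Φ(F \ 0) , Φ(F \ 0) + 2 Φ(F / 0)).
With ε ≈ 1 / n there are two cases for an active first item. If 2 Φ(F / 0) ≤ ε Φ(F \ 0), rejecting it
costs at most p ε in log Φ, and p ≤ V(F) pays for that. Otherwise log Φ(F / 0) is within log₂ (1 / ε) + O(1) of
log Φ(F \ 0), so the unit gained by accepting pays for the loss, at a price of log₂ n + O(1) per unit.
Hence log Φ(F) ≤ (log₂ n + O(1)) V(F) by induction, and 𝔼 opt F ≤ log₂ Φ(F) by convexity. To remain
within ℚ, log₂ is replaced by its piecewise linear interpolation at the powers of 2.
-}
module Submission where

open import Defs
open import Data.Nat using (ℕ; suc)
import Data.Nat as ℕ
open import Data.Nat.Logarithm using (⌊log₂_⌋)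
open import Data.Vec using (Vec)
open import Data.Product using (Σ-syntax)
open import Data.Rational using (ℚ; _*_; _≤_)

open import Data.Bool using (Bool; true; false; if_then_else_; _∧_)
open import Data.Bool.Properties using (∨-identityʳ)
open import Data.Fin using (zero; suc)
open import Data.Fin.Subset using (Subset; _∪_; ⁅_⁆; ⊥; inside; outside)
open import Data.Fin.Subset.Properties using (∪-identityˡ; out⊆; s⊆s; ⊥⊆; ⊆-refl)
open import Data.List using (List; []; _∷_; _++_; [_]; map; foldr; concatMap; allFin; tabulate)
open import Data.List.Properties using (map-tabulate)
open import Data.List.Membership.Propositional using (_∈_)
open import Data.List.Relation.Unary.Any using (here; there)
open import Data.Nat using (zero)
open import Data.Nat.Logarithm using (⌊log₂⌋-mono-≤; ⌊log₂[2^n]⌋≡n)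
import Data.Nat.Properties as ℕₚ
open import Data.Product using (_×_; _,_; ∃-syntax)
open import Data.Rational using (0ℚ; 1ℚ; ½; _+_; _-_; -_; _⊔_; _≤?_; nonNegative; toℚᵘ)
open import Data.Rational.Properties
open import Data.Rational.Solver using (module +-*-Solver)
open import Data.Rational.Unnormalised using (mkℚᵘ; *≡*)
import Data.Rational.Unnormalised as ℚᵘ
import Data.Rational.Unnormalised.Properties as ℚᵘₚ
open import Data.Integer using (+_)
import Data.Integer.Solver as ℤ-Solver
open import Data.Sum using (_⊎_; inj₁; inj₂)
open import Data.Vec using ([]; _∷_; lookup)
open import Function using (_∘_)
open import Relation.Binary.PropositionalEquality using (_≡_; refl; sym; trans; cong; cong₂; subst; subst₂; _≗_)
open import Relation.Nullary using (Dec; does; yes; no; contradiction)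

open +-*-Solver using (solve; _:+_; _:*_; _:-_; _:=_; con)

-- Arithmetic and order in the rationals.

-- `toℚ` normalises by a gcd that is stuck on a variable, so the equation is checked on unnormalised
-- fractions of denominator 1.
toℚ-+ : ∀ m n → toℚ (m ℕ.+ n) ≡ toℚ m + toℚ n
toℚ-+ m n = toℚᵘ-injective (begin
  toℚᵘ (toℚ (m ℕ.+ n))                      ≈⟨ toℚᵘ-fromℚᵘ (mkℚᵘ (+ (m ℕ.+ n)) 0) ⟩
  mkℚᵘ (+ (m ℕ.+ n)) 0                      ≈⟨ *≡* (ℤ.solve 2 (λ a b → (a ℤ.:+ b) ℤ.:* ℤ.con (+ 1)
                                                ℤ.:= (a ℤ.:* ℤ.con (+ 1) ℤ.:+ b ℤ.:* ℤ.con (+ 1)) ℤ.:* ℤ.con (+ 1))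
                                                refl (+ m) (+ n)) ⟩
  mkℚᵘ (+ m) 0 ℚᵘ.+ mkℚᵘ (+ n) 0            ≈⟨ ℚᵘₚ.+-cong (toℚᵘ-fromℚᵘ (mkℚᵘ (+ m) 0)) (toℚᵘ-fromℚᵘ (mkℚᵘ (+ n) 0)) ⟨
  toℚᵘ (toℚ m) ℚᵘ.+ toℚᵘ (toℚ n)            ≈⟨ toℚᵘ-homo-+ (toℚ m) (toℚ n) ⟨
  toℚᵘ (toℚ m + toℚ n)                      ∎)
  where
  open import Relation.Binary.Reasoning.Setoid ℚᵘₚ.≃-setoid
  module ℤ = ℤ-Solver.+-*-Solver

toℚ-nonNeg : ∀ n → 0ℚ ≤ toℚ n
toℚ-nonNeg n = nonNegative⁻¹ (toℚ n) {{normalize-nonNeg n 1}}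

toℚ-mono : ∀ {m n} → m ℕ.≤ n → toℚ m ≤ toℚ n
toℚ-mono {m} {n} m≤n = begin
  toℚ m                    ≡⟨ +-identityʳ (toℚ m) ⟨
  toℚ m + 0ℚ               ≤⟨ +-monoʳ-≤ (toℚ m) (toℚ-nonNeg (n ℕ.∸ m)) ⟩
  toℚ m + toℚ (n ℕ.∸ m)    ≡⟨ toℚ-+ m (n ℕ.∸ m) ⟨
  toℚ (m ℕ.+ (n ℕ.∸ m))    ≡⟨ cong toℚ (ℕₚ.m+[n∸m]≡n m≤n) ⟩
  toℚ n                    ∎
  where open ≤-Reasoning

*-monoˡ : ∀ {r p q} → 0ℚ ≤ r → p ≤ q → r * p ≤ r * q
*-monoˡ {r} 0≤r = *-monoˡ-≤-nonNeg r {{nonNegative 0≤r}}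

*-monoʳ : ∀ {r p q} → 0ℚ ≤ r → p ≤ q → p * r ≤ q * r
*-monoʳ {r} 0≤r = *-monoʳ-≤-nonNeg r {{nonNegative 0≤r}}

*-nonNeg : ∀ {p q} → 0ℚ ≤ p → 0ℚ ≤ q → 0ℚ ≤ p * q
*-nonNeg {p} {q} 0≤p 0≤q = subst (_≤ p * q) (*-zeroʳ p) (*-monoˡ 0≤p 0≤q)

p≤q⇒0≤q-p : ∀ {p q} → p ≤ q → 0ℚ ≤ q - p
p≤q⇒0≤q-p {p} {q} p≤q = subst (_≤ q - p) (+-inverseʳ p) (+-monoˡ-≤ (- p) p≤q)

p≤q⇒p≤r+q : ∀ {p q r} → 0ℚ ≤ r → p ≤ q → p ≤ r + q
p≤q⇒p≤r+q {p} {q} {r} 0≤r p≤q = subst (_≤ r + q) (+-identityˡ p) (+-mono-≤ 0≤r p≤q)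

p≤q⇒p≤q+r : ∀ {p q r} → 0ℚ ≤ r → p ≤ q → p ≤ q + r
p≤q⇒p≤q+r {p} {q} {r} 0≤r p≤q = subst (_≤ q + r) (+-identityʳ p) (+-mono-≤ p≤q 0≤r)

-- Powers of one half and chords of `2 ^ j`.

½^_ : ℕ → ℚ
½^ zero  = 1ℚ
½^ suc n = ½ * ½^ n

½^-nonNeg : ∀ n → 0ℚ ≤ ½^ n
½^-nonNeg zero    = nonNegative⁻¹ 1ℚ
½^-nonNeg (suc n) = *-nonNeg (nonNegative⁻¹ ½) (½^-nonNeg n)

½^-+ : ∀ m n → ½^ (m ℕ.+ n) ≡ ½^ m * ½^ n
½^-+ zero    n = sym (*-identityˡ _)
½^-+ (suc m) n = trans (cong (½ *_) (½^-+ m n)) (sym (*-assoc ½ (½^ m) (½^ n)))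

n<2^n : ∀ n → n ℕ.< 2 ℕ.^ n
n<2^n zero    = ℕₚ.≤-refl
n<2^n (suc n) = ℕₚ.+-mono-≤ (ℕₚ.m^n>0 2 n) (ℕₚ.≤-trans (n<2^n n) (ℕₚ.m≤m+n _ 0))

toℚ-double : ∀ n → toℚ (2 ℕ.* n) ≡ toℚ n + toℚ n
toℚ-double n = trans (cong (toℚ ∘ (n ℕ.+_)) (ℕₚ.+-identityʳ n)) (toℚ-+ n n)

2^*½^-suc : ∀ j k → toℚ (2 ℕ.^ suc j) * ½^ suc k ≡ toℚ (2 ℕ.^ j) * ½^ k
2^*½^-suc j k = trans (cong (_* ½^ suc k) (toℚ-double (2 ℕ.^ j)))
  (solve 2 (λ a t → (a :+ a) :* (con ½ :* t) := a :* t) refl (toℚ (2 ℕ.^ j)) (½^ k))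

2^*½^≡1 : ∀ k → toℚ (2 ℕ.^ k) * ½^ k ≡ 1ℚ
2^*½^≡1 zero    = refl
2^*½^≡1 (suc k) = trans (2^*½^-suc k k) (2^*½^≡1 k)

-- At integers j, the convex function 2 ^ j lies above its chord through k and k + 1.
tangent-≤-2^ : ∀ j k → toℚ (suc j) ≤ toℚ k + toℚ (2 ℕ.^ j) * ½^ k
tangent-≤-2^ j zero = begin
  toℚ (suc j)                ≤⟨ toℚ-mono (n<2^n j) ⟩
  toℚ (2 ℕ.^ j)              ≡⟨ solve 1 (λ a → a := con 0ℚ :+ a :* con 1ℚ) refl _ ⟩
  0ℚ + toℚ (2 ℕ.^ j) * 1ℚ    ∎
  where open ≤-Reasoning
tangent-≤-2^ zero (suc k) = begin
  1ℚ                         ≡⟨ +-identityʳ 1ℚ ⟨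
  1ℚ + 0ℚ                    ≤⟨ +-mono-≤ (toℚ-mono {1} {suc k} (ℕ.s≤s ℕ.z≤n))
                                  (*-nonNeg (toℚ-nonNeg 1) (½^-nonNeg (suc k))) ⟩
  toℚ (suc k) + 1ℚ * ½^ suc k ∎
  where open ≤-Reasoning
tangent-≤-2^ (suc j) (suc k) = begin
  toℚ (suc (suc j))                               ≡⟨ toℚ-+ 1 (suc j) ⟩
  1ℚ + toℚ (suc j)                                ≤⟨ +-monoʳ-≤ 1ℚ (tangent-≤-2^ j k) ⟩
  1ℚ + (toℚ k + toℚ (2 ℕ.^ j) * ½^ k)             ≡⟨ +-assoc 1ℚ (toℚ k) _ ⟨
  (1ℚ + toℚ k) + toℚ (2 ℕ.^ j) * ½^ k             ≡⟨ cong₂ _+_ (toℚ-+ 1 k) (2^*½^-suc j k) ⟨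
  toℚ (suc k) + toℚ (2 ℕ.^ suc j) * ½^ suc k      ∎
  where open ≤-Reasoning

-- Expectations over independent bits.

mix : ℚ → ℚ → ℚ → ℚ
mix p a b = (1ℚ - p) * a + p * b

mix-idem : ∀ p a → mix p a a ≡ a
mix-idem = solve 2 (λ p a → (con 1ℚ :- p) :* a :+ p :* a := a) refl

module _ {p : ℚ} (0≤p : 0ℚ ≤ p) (p≤1 : p ≤ 1ℚ) where

  mix-mono : ∀ {a b a′ b′} → a ≤ a′ → b ≤ b′ → mix p a b ≤ mix p a′ b′
  mix-mono a≤a′ b≤b′ = +-mono-≤ (*-monoˡ (p≤q⇒0≤q-p p≤1) a≤a′) (*-monoˡ 0≤p b≤b′)

-- Recursive form of `expect`: each layer conditions on the first item, as the induction on the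
-- number of items does.
𝔼 : ∀ {n} → Vec ℚ n → (Outcome n → ℚ) → ℚ
𝔼 []       f = f []
𝔼 (p ∷ ps) f = mix p (𝔼 ps (f ∘ (false ∷_))) (𝔼 ps (f ∘ (true ∷_)))

weightedSum : ∀ {n} → Vec ℚ n → (Outcome n → ℚ) → List (Outcome n) → ℚ
weightedSum p f = foldr (λ x acc → prob p x * f x + acc) 0ℚ

-- Stated for an arbitrary list, since the induction runs over the outcomes of the tail, each of
-- which is extended in two adjacent ways.
weightedSum-∷ : ∀ {n} p (ps : Vec ℚ n) f xs →
  weightedSum (p ∷ ps) f (concatMap (λ v → (false ∷ v) ∷ (true ∷ v) ∷ []) xs)
    ≡ mix p (weightedSum ps (f ∘ (false ∷_)) xs) (weightedSum ps (f ∘ (true ∷_)) xs)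
weightedSum-∷ p ps f []       = sym (mix-idem p 0ℚ)
weightedSum-∷ p ps f (x ∷ xs) = trans
  (cong (λ s → (1ℚ - p) * prob ps x * f (false ∷ x) + (p * prob ps x * f (true ∷ x) + s))
        (weightedSum-∷ p ps f xs))
  (solve 6 (λ p w a b s t →
      (con 1ℚ :- p) :* w :* a :+ (p :* w :* b :+ ((con 1ℚ :- p) :* s :+ p :* t))
      := (con 1ℚ :- p) :* (w :* a :+ s) :+ p :* (w :* b :+ t))
    refl p (prob ps x) (f (false ∷ x)) (f (true ∷ x)) _ _)

weightedSum≡𝔼 : ∀ {n} (ps : Vec ℚ n) f → weightedSum ps f (allOutcomes n) ≡ 𝔼 ps f
weightedSum≡𝔼 []       f = solve 1 (λ a → con 1ℚ :* a :+ con 0ℚ := a) refl (f [])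
weightedSum≡𝔼 (p ∷ ps) f = trans (weightedSum-∷ p ps f (allOutcomes _))
  (cong₂ (mix p) (weightedSum≡𝔼 ps _) (weightedSum≡𝔼 ps _))

expect≡𝔼 : ∀ {n} (ps : Vec ℚ n) f → expect ps f ≡ 𝔼 ps (toℚ ∘ f)
expect≡𝔼 ps f = weightedSum≡𝔼 ps (toℚ ∘ f)

𝔼-cong : ∀ {n} (ps : Vec ℚ n) {f g} → f ≗ g → 𝔼 ps f ≡ 𝔼 ps g
𝔼-cong []       f≗g = f≗g []
𝔼-cong (p ∷ ps) f≗g = cong₂ (mix p) (𝔼-cong ps (f≗g ∘ (false ∷_))) (𝔼-cong ps (f≗g ∘ (true ∷_)))

𝔼-mono : ∀ {n} (ps : Vec ℚ n) → ValidProbs ps → ∀ {f g} → (∀ x → f x ≤ g x) → 𝔼 ps f ≤ 𝔼 ps g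
𝔼-mono []       _                f≤g = f≤g []
𝔼-mono (p ∷ ps) (0≤p , p≤1 , vs) f≤g =
  mix-mono 0≤p p≤1 (𝔼-mono ps vs (f≤g ∘ (false ∷_))) (𝔼-mono ps vs (f≤g ∘ (true ∷_)))

𝔼-const : ∀ {n} (ps : Vec ℚ n) c → 𝔼 ps (λ _ → c) ≡ c
𝔼-const []       c = refl
𝔼-const (p ∷ ps) c = trans (cong₂ (mix p) (𝔼-const ps c) (𝔼-const ps c)) (mix-idem p c)

𝔼-+ : ∀ {n} (ps : Vec ℚ n) f g → 𝔼 ps (λ x → f x + g x) ≡ 𝔼 ps f + 𝔼 ps g
𝔼-+ []       f g = refl
𝔼-+ (p ∷ ps) f g = trans
  (cong₂ (mix p) (𝔼-+ ps _ _) (𝔼-+ ps _ _))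
  (solve 5 (λ p a b c d → (con 1ℚ :- p) :* (a :+ b) :+ p :* (c :+ d)
     := ((con 1ℚ :- p) :* a :+ p :* c) :+ ((con 1ℚ :- p) :* b :+ p :* d)) refl p _ _ _ _)

𝔼-scale : ∀ {n} (ps : Vec ℚ n) f d → 𝔼 ps (λ x → f x * d) ≡ 𝔼 ps f * d
𝔼-scale []       f d = refl
𝔼-scale (p ∷ ps) f d = trans
  (cong₂ (mix p) (𝔼-scale ps _ d) (𝔼-scale ps _ d))
  (solve 4 (λ p d a b → (con 1ℚ :- p) :* (a :* d) :+ p :* (b :* d)
     := ((con 1ℚ :- p) :* a :+ p :* b) :* d) refl p d _ _)

𝔼-shift : ∀ {n} (ps : Vec ℚ n) c f → 𝔼 ps (λ x → c + f x) ≡ c + 𝔼 ps f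
𝔼-shift ps c f = trans (𝔼-+ ps (λ _ → c) f) (cong (_+ 𝔼 ps f) (𝔼-const ps c))

-- Deletion, contraction and the offline optimum.

infixl 6 _▹_

_▹_ : ∀ {n} → Family (suc n) → Bool → Family n
(F ▹ w) S = F (w ∷ S)

▹-downwardClosed : ∀ {n} {F : Family (suc n)} → DownwardClosed F → ∀ w → DownwardClosed (F ▹ w)
▹-downwardClosed dc w S T S⊆T = dc (w ∷ S) (w ∷ T) (s⊆s S⊆T)

∈-allSubsets : ∀ {n} (S : Subset n) → S ∈ allSubsets n
∈-allSubsets []      = here refl
∈-allSubsets (s ∷ S) = both s (∈-allSubsets S)
  where
  both : ∀ s {Ss} → S ∈ Ss → (s ∷ S) ∈ concatMap (λ v → (false ∷ v) ∷ (true ∷ v) ∷ []) Ss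
  both false (here refl) = here refl
  both true  (here refl) = there (here refl)
  both s     (there S∈)  = there (there (both s S∈))

-- Together with `opt-least` this characterises `opt` as a maximum; all later facts about `opt` rest
-- on these two.
opt-upper : ∀ {n} (F : Family n) x S → F S ≡ true → value x S ℕ.≤ opt F x
opt-upper {n} F x S FS = go (∈-allSubsets S)
  where
  go : ∀ {Ss} → S ∈ Ss → value x S ℕ.≤ foldr (λ T m → if F T then value x T ℕ.⊔ m else m) 0 Ss
  go (here refl) rewrite FS = ℕₚ.m≤m⊔n _ _
  go {T ∷ _} (there S∈) with F T
  ... | true  = ℕₚ.≤-trans (go S∈) (ℕₚ.m≤n⊔m (value x T) _)
  ... | false = go S∈

opt-least : ∀ {n} (F : Family n) x {b} → (∀ S → F S ≡ true → value x S ℕ.≤ b) → opt F x ℕ.≤ b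
opt-least {n} F x {b} bound = go (allSubsets n)
  where
  go : ∀ Ss → foldr (λ T m → if F T then value x T ℕ.⊔ m else m) 0 Ss ℕ.≤ b
  -- The default 0 of the fold lies below every bound, so a family without members is covered.
  go []       = ℕ.z≤n
  go (T ∷ Ss) with F T in FT
  ... | true  = ℕₚ.⊔-lub (bound T FT) (go Ss)
  ... | false = go Ss

opt-mono : ∀ {n} {F G : Family n} → (∀ S → F S ≡ true → G S ≡ true) → ∀ x → opt F x ℕ.≤ opt G x
opt-mono {F = F} {G} F⊆G x = opt-least F x (λ S FS → opt-upper G x S (F⊆G S FS))

module _ {n} {F : Family (suc n)} (dc : DownwardClosed F) where

  contraction⊆deletion : ∀ S → (F ▹ inside) S ≡ true → (F ▹ outside) S ≡ true
  contraction⊆deletion S = dc (outside ∷ S) (inside ∷ S) (out⊆ ⊆-refl)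

  -- Removing an item of value 0 costs nothing, and downward closure keeps the rest feasible.
  opt-inactive : ∀ x → opt F (false ∷ x) ℕ.≤ opt (F ▹ outside) x
  opt-inactive x = opt-least F (false ∷ x) λ where
    (outside ∷ S) FS → opt-upper (F ▹ outside) x S FS
    (inside  ∷ S) FS → opt-upper (F ▹ outside) x S (contraction⊆deletion S FS)

  opt-active : ∀ x → opt F (true ∷ x) ℕ.≤ opt (F ▹ outside) x ℕ.⊔ suc (opt (F ▹ inside) x)
  opt-active x = opt-least F (true ∷ x) λ where
    (outside ∷ S) FS → ℕₚ.m≤n⇒m≤n⊔o _ (opt-upper (F ▹ outside) x S FS)
    (inside  ∷ S) FS → ℕₚ.m≤n⇒m≤o⊔n (opt (F ▹ outside) x) (ℕ.s≤s (opt-upper (F ▹ inside) x S FS))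

  -- A feasible set through the first item would make the singleton of that item feasible.
  opt-infeasible : F (inside ∷ ⊥) ≡ false → ∀ x → opt F (true ∷ x) ℕ.≤ opt (F ▹ outside) x
  opt-infeasible F⁅0⁆ x = opt-least F (true ∷ x) λ where
    (outside ∷ S) FS → opt-upper (F ▹ outside) x S FS
    (inside  ∷ S) FS → contradiction (trans (sym (dc _ _ (s⊆s ⊥⊆) FS)) F⁅0⁆) λ ()

-- The dynamic programming strategy and its value.

-- Skipping item 0 deletes it from F, taking it contracts it.
onlineValue : ∀ {n} → Family n → Vec ℚ n → ℚ
onlineValue F []       = 0ℚ
onlineValue F (p ∷ ps) = mix p (onlineValue (F ▹ outside) ps)
  (if F (inside ∷ ⊥) then onlineValue (F ▹ outside) ps ⊔ (1ℚ + onlineValue (F ▹ inside) ps)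
                     else onlineValue (F ▹ outside) ps)

-- Only the two continuation values are compared, because `runFrom` tests feasibility itself. Ties
-- are accepted.
takes : ∀ {n} → Family (suc n) → Vec ℚ n → Bool → Bool
takes F ps b = b ∧ does (onlineValue (F ▹ outside) ps ≤? 1ℚ + onlineValue (F ▹ inside) ps)

-- A `Strategy` sees only the observed values, so it replays its earlier decisions, feasibility test
-- included, to recover the current minor of `F`.
optimal : ∀ {n} → Family n → Vec ℚ n → Strategy
optimal F []       _           = false
optimal F (p ∷ ps) []          = false
optimal F (p ∷ ps) (b ∷ [])    = takes F ps b
optimal F (p ∷ ps) (b ∷ c ∷ h) = optimal (F ▹ (takes F ps b ∧ F (inside ∷ ⊥))) ps (c ∷ h)

module _ (σ τ : Strategy) (b : Bool) (σ≗τ : ∀ c h → σ (b ∷ c ∷ h) ≡ τ (c ∷ h)) where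

  snoc-agree : ∀ h c → σ (b ∷ h ++ [ c ]) ≡ τ (h ++ [ c ])
  snoc-agree []      c = σ≗τ c []
  snoc-agree (d ∷ h) c = σ≗τ d _

  -- The remaining items are all successors, so the first coordinate `w` of the chosen set is frozen
  -- and the run takes place in `F ▹ w`.
  runFrom-∷ : ∀ {n} (F : Family (suc n)) w x →
    ∀ is h W → runFrom F σ (b ∷ x) (map suc is) (b ∷ h) (w ∷ W) ≡ w ∷ runFrom (F ▹ w) τ x is h W
  runFrom-∷ F w x []       h W = refl
  runFrom-∷ F w x (i ∷ is) h W
    rewrite ∨-identityʳ w | snoc-agree h (lookup x i)
    with τ (h ++ [ lookup x i ]) ∧ F (w ∷ (W ∪ ⁅ i ⁆))
  ... | true  = runFrom-∷ F w x is _ _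
  ... | false = runFrom-∷ F w x is _ _

  runFrom-1 : ∀ {n} (F : Family (suc n)) w x W →
    runFrom F σ (b ∷ x) (tabulate suc) [ b ] (w ∷ W) ≡ w ∷ runFrom (F ▹ w) τ x (allFin n) [] W
  runFrom-1 {n} F w x W =
    subst (λ is → runFrom F σ (b ∷ x) is [ b ] (w ∷ W) ≡ w ∷ runFrom (F ▹ w) τ x (allFin n) [] W)
          (map-tabulate (λ i → i) suc) (runFrom-∷ F w x (allFin n) [] W)

  run-∷ : ∀ {n} (F : Family (suc n)) x →
    let w = σ [ b ] ∧ F (inside ∷ ⊥) in run F σ (b ∷ x) ≡ w ∷ run (F ▹ w) τ x
  run-∷ {n} F x
    -- Adding the first item to the empty set leaves `⊥ ∪ ⊥` in the tail.
    rewrite ∪-identityˡ {n = n} ⊥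
    with σ [ b ] ∧ F (inside ∷ ⊥)
  ... | true  = runFrom-1 F inside x ⊥
  ... | false = runFrom-1 F outside x ⊥

run-optimal-∷ : ∀ {n} (F : Family (suc n)) p ps b x →
  let w = takes F ps b ∧ F (inside ∷ ⊥) in
  run F (optimal F (p ∷ ps)) (b ∷ x) ≡ w ∷ run (F ▹ w) (optimal (F ▹ w) ps) x
run-optimal-∷ F p ps b x = run-∷ (optimal F (p ∷ ps)) _ b (λ c h → refl) F x

if-≤-then-max : ∀ {a b} (a≤?b : Dec (a ≤ b)) f →
  (if does a≤?b ∧ f then b else a) ≡ (if f then a ⊔ b else a)
if-≤-then-max (yes a≤b) false = refl
if-≤-then-max (no  a≰b) false = refl
if-≤-then-max (yes a≤b) true  = sym (p≤q⇒p⊔q≡q a≤b)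
if-≤-then-max (no  a≰b) true  = sym (p≥q⇒p⊔q≡p (<⇒≤ (≰⇒> a≰b)))

strategyValue : ∀ {n} → Family n → Vec ℚ n → ℚ
strategyValue F ps = 𝔼 ps (λ x → toℚ (value x (run F (optimal F ps) x)))

-- After the first decision the strategy is again the one for the deletion or the contraction.
-- Accepting an active item adds a constant 1, which leaves the expectation.
strategyValue≡onlineValue : ∀ {n} (F : Family n) ps → strategyValue F ps ≡ onlineValue F ps
strategyValue≡onlineValue F []       = refl
strategyValue≡onlineValue F (p ∷ ps) = cong₂ (mix p)
  (trans (𝔼-cong ps (λ x → cong (toℚ ∘ value (false ∷ x)) (run-optimal-∷ F p ps false x)))
         (strategyValue≡onlineValue (F ▹ outside) ps))
  (trans (𝔼-cong ps (λ x → cong (toℚ ∘ value (true ∷ x)) (run-optimal-∷ F p ps true x)))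
         active)
  where
  V₀ = onlineValue (F ▹ outside) ps
  V₁ = onlineValue (F ▹ inside) ps

  gain : ∀ w → 𝔼 ps (λ x → toℚ (value (true ∷ x) (w ∷ run (F ▹ w) (optimal (F ▹ w) ps) x)))
    ≡ (if w then 1ℚ + V₁ else V₀)
  gain true  = trans (𝔼-cong ps (λ x → toℚ-+ 1 (value x (run (F ▹ inside) (optimal (F ▹ inside) ps) x))))
    (trans (𝔼-shift ps 1ℚ _) (cong (λ v → 1ℚ + v) (strategyValue≡onlineValue (F ▹ inside) ps)))
  gain false = strategyValue≡onlineValue (F ▹ outside) ps

  active : _ ≡ _
  active = trans (gain (takes F ps true ∧ F (inside ∷ ⊥))) (if-≤-then-max (V₀ ≤? 1ℚ + V₁) (F (inside ∷ ⊥)))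

-- Read off from the strategy, whose value is an expectation of naturals.
onlineValue-nonNeg : ∀ {n} (F : Family n) ps → ValidProbs ps → 0ℚ ≤ onlineValue F ps
onlineValue-nonNeg F ps vs = begin
  0ℚ                   ≡⟨ 𝔼-const ps 0ℚ ⟨
  𝔼 ps (λ _ → 0ℚ)      ≤⟨ 𝔼-mono ps vs (λ x → toℚ-nonNeg (value x (run F (optimal F ps) x))) ⟩
  strategyValue F ps   ≡⟨ strategyValue≡onlineValue F ps ⟩
  onlineValue F ps     ∎
  where open ≤-Reasoning

-- The exponential potential.

potential : ∀ {n} → Family n → Vec ℚ n → ℚ
potential F ps = 𝔼 ps (λ x → toℚ (2 ℕ.^ opt F x))

2ℚ : ℚ
2ℚ = toℚ 2

toℚ-2^-mono : ∀ {m n} → m ℕ.≤ n → toℚ (2 ℕ.^ m) ≤ toℚ (2 ℕ.^ n)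
toℚ-2^-mono m≤n = toℚ-mono (ℕₚ.^-monoʳ-≤ 2 m≤n)

-- The maximum becomes a sum of exponentials, which commutes with expectation.
toℚ-2^-⊔ : ∀ {l} m n → l ℕ.≤ m ℕ.⊔ suc n → toℚ (2 ℕ.^ l) ≤ toℚ (2 ℕ.^ m) + toℚ (2 ℕ.^ n) * 2ℚ
toℚ-2^-⊔ {l} m n l≤ with ℕₚ.⊔-sel m (suc n)
... | inj₁ eq = p≤q⇒p≤q+r (*-nonNeg (toℚ-nonNeg (2 ℕ.^ n)) (toℚ-nonNeg 2))
  (toℚ-2^-mono {l} {m} (subst (l ℕ.≤_) eq l≤))
... | inj₂ eq = p≤q⇒p≤r+q (toℚ-nonNeg (2 ℕ.^ m)) (begin
  toℚ (2 ℕ.^ l)                    ≤⟨ toℚ-2^-mono {l} {suc n} (subst (l ℕ.≤_) eq l≤) ⟩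
  toℚ (2 ℕ.^ suc n)                ≡⟨ toℚ-double (2 ℕ.^ n) ⟩
  toℚ (2 ℕ.^ n) + toℚ (2 ℕ.^ n)    ≡⟨ solve 1 (λ a → a :+ a := a :* con 2ℚ) refl (toℚ (2 ℕ.^ n)) ⟩
  toℚ (2 ℕ.^ n) * 2ℚ               ∎)
  where open ≤-Reasoning

module _ {n} {F : Family (suc n)} (dc : DownwardClosed F) (ps : Vec ℚ n) (vs : ValidProbs ps) where

  private
    Φ₀ = potential (F ▹ outside) ps
    Φ₁ = potential (F ▹ inside) ps
    Φ⁺ = 𝔼 ps (λ x → toℚ (2 ℕ.^ opt F (true ∷ x)))

  potential-step : ∀ {p a} → 0ℚ ≤ p → p ≤ 1ℚ → Φ⁺ ≤ a → potential F (p ∷ ps) ≤ mix p Φ₀ a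
  potential-step 0≤p p≤1 = mix-mono 0≤p p≤1 (𝔼-mono ps vs (λ x → toℚ-2^-mono (opt-inactive dc x)))

  -- The contraction is contained in the deletion, so an active item raises the optimum of the
  -- deletion by at most 1.
  active-≤-double : Φ⁺ ≤ Φ₀ + Φ₀
  active-≤-double = ≤-trans (𝔼-mono ps vs bound) (≤-reflexive (𝔼-+ ps _ _))
    where
    bound : ∀ x → toℚ (2 ℕ.^ opt F (true ∷ x))
      ≤ toℚ (2 ℕ.^ opt (F ▹ outside) x) + toℚ (2 ℕ.^ opt (F ▹ outside) x)
    bound x = begin
      toℚ (2 ℕ.^ opt F (true ∷ x))             ≤⟨ toℚ-2^-mono (ℕₚ.≤-trans (opt-active dc x)
                                                    (ℕₚ.⊔-lub (ℕₚ.n≤1+n o) (ℕ.s≤s (opt-mono (contraction⊆deletion dc) x)))) ⟩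
      toℚ (2 ℕ.^ suc o)                        ≡⟨ toℚ-double (2 ℕ.^ o) ⟩
      toℚ (2 ℕ.^ o) + toℚ (2 ℕ.^ o)            ∎
      where
      open ≤-Reasoning
      o = opt (F ▹ outside) x

  -- Keeps the share of the contraction separate, which beats doubling when `Φ₁` is small.
  active-≤-choice : Φ⁺ ≤ Φ₀ + Φ₁ * 2ℚ
  active-≤-choice = ≤-trans (𝔼-mono ps vs (λ x → toℚ-2^-⊔ (opt (F ▹ outside) x) (opt (F ▹ inside) x) (opt-active dc x)))
    (≤-reflexive (trans (𝔼-+ ps _ _) (cong (λ e → Φ₀ + e) (𝔼-scale ps _ 2ℚ))))

  active-≤-skip : F (inside ∷ ⊥) ≡ false → Φ⁺ ≤ Φ₀
  active-≤-skip F⁅0⁆ = 𝔼-mono ps vs (λ x → toℚ-2^-mono (opt-infeasible dc F⁅0⁆ x))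

-- Logarithmic bounds by chords.

-- Says that ℓ φ ≤ R, where ℓ is the piecewise linear interpolation of log₂ at the powers of 2:
-- as ℓ is concave, ℓ φ is the least of the numbers k - 1 + φ / 2 ^ k. The first condition keeps
-- k from being far below the minimiser.
LogBound : ℚ → ℚ → Set
LogBound φ R = ∃[ k ] (φ * ½^ k ≤ 2ℚ × toℚ k + φ * ½^ k ≤ 1ℚ + R)

-- Passing from `k` to `suc k` halves y = `φ * ½^ k` and changes the left-hand side by 1 - y / 2,
-- which is at most 0 once y is at least 2.
logBound-normalise : ∀ {φ R} k → φ * ½^ k ≤ 2ℚ + 2ℚ → toℚ k + φ * ½^ k ≤ 1ℚ + R → LogBound φ R
logBound-normalise {φ} {R} k ≤4 ≤R with ≤-total (φ * ½^ k) 2ℚ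
... | inj₁ ≤2 = k , ≤2 , ≤R
... | inj₂ 2≤ = suc k ,
  ≤-trans (≤-reflexive halve) (*-monoˡ (nonNegative⁻¹ ½) ≤4) ,
  (begin
    toℚ (suc k) + φ * ½^ suc k                         ≡⟨ cong₂ _+_ (toℚ-+ 1 k) halve ⟩
    1ℚ + toℚ k + ½ * (φ * ½^ k)                        ≡⟨ solve 2 (λ κ y → con 1ℚ :+ κ :+ con ½ :* y
                                                            := κ :+ (con ½ :* con 2ℚ :+ con ½ :* y)) refl (toℚ k) (φ * ½^ k) ⟩
    toℚ k + (½ * 2ℚ + ½ * (φ * ½^ k))                  ≤⟨ +-monoʳ-≤ (toℚ k) (+-monoˡ-≤ (½ * (φ * ½^ k)) (*-monoˡ (nonNegative⁻¹ ½) 2≤)) ⟩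
    toℚ k + (½ * (φ * ½^ k) + ½ * (φ * ½^ k))          ≡⟨ solve 2 (λ κ y → κ :+ (con ½ :* y :+ con ½ :* y) := κ :+ y) refl (toℚ k) (φ * ½^ k) ⟩
    toℚ k + φ * ½^ k                                   ≤⟨ ≤R ⟩
    1ℚ + R                                             ∎)
  where
  open ≤-Reasoning
  halve : φ * ½^ suc k ≡ ½ * (φ * ½^ k)
  halve = solve 2 (λ φ t → φ :* (con ½ :* t) := con ½ :* (φ :* t)) refl φ (½^ k)

-- The hypothesis says that `φ` is at least 2 ^ (k - m - 1), so an upper bound `R` on its logarithm
-- cannot lie below k - m - 1.
logBound-level : ∀ {φ R} k m → ½^ m ≤ φ * 2ℚ * ½^ k → LogBound φ R → toℚ (suc k) ≤ toℚ (suc m) + (1ℚ + R)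
logBound-level {φ} {R} k m large (j , _ , ≤R) = begin
  -- The chord is taken at `suc m ℕ.+ j`, with `j` the witness for `φ`. Its coefficient splits into
  -- `½^ m`, which `large` trades for `φ`, and `½^ j`, which rebuilds the inequality of the witness.
  toℚ (suc k)                                                   ≤⟨ tangent-≤-2^ k (suc m ℕ.+ j) ⟩
  toℚ (suc m ℕ.+ j) + toℚ (2 ℕ.^ k) * ½^ (suc m ℕ.+ j)          ≡⟨ cong₂ _+_ (toℚ-+ (suc m) j)
                                                                     (trans (cong (toℚ (2 ℕ.^ k) *_) (½^-+ (suc m) j))
                                                                       (solve 3 (λ u s t → u :* ((con ½ :* s) :* t) := con ½ :* t :* u :* s)
                                                                          refl (toℚ (2 ℕ.^ k)) (½^ m) (½^ j))) ⟩
  toℚ (suc m) + toℚ j + ½ * ½^ j * toℚ (2 ℕ.^ k) * ½^ m         ≤⟨ +-monoʳ-≤ (toℚ (suc m) + toℚ j)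
                                                                     (*-monoˡ (*-nonNeg (½^-nonNeg (suc j)) (toℚ-nonNeg (2 ℕ.^ k))) large) ⟩
  toℚ (suc m) + toℚ j + ½ * ½^ j * toℚ (2 ℕ.^ k) * (φ * 2ℚ * ½^ k)
                                                                ≡⟨ solve 6 (λ μ κ t u φ s → μ :+ κ :+ con ½ :* t :* u :* (φ :* con 2ℚ :* s)
                                                                     := μ :+ (κ :+ φ :* t :* (u :* s)))
                                                                     refl (toℚ (suc m)) (toℚ j) (½^ j) (toℚ (2 ℕ.^ k)) φ (½^ k) ⟩
  toℚ (suc m) + (toℚ j + φ * ½^ j * (toℚ (2 ℕ.^ k) * ½^ k))     ≡⟨ cong (λ e → toℚ (suc m) + (toℚ j + e))
                                                                     (trans (cong (φ * ½^ j *_) (2^*½^≡1 k)) (*-identityʳ _)) ⟩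
  toℚ (suc m) + (toℚ j + φ * ½^ j)                              ≤⟨ +-monoʳ-≤ (toℚ (suc m)) ≤R ⟩
  toℚ (suc m) + (1ℚ + R)                                        ∎
  where open ≤-Reasoning

-- The cost of rejecting or accepting one item.

module _ {p V₀ : ℚ} (0≤p : 0ℚ ≤ p) (p≤1 : p ≤ 1ℚ) where

  mix-⊔ʳ : ∀ b → mix p V₀ b ≤ mix p V₀ (V₀ ⊔ b)
  mix-⊔ʳ b = mix-mono 0≤p p≤1 ≤-refl (p≤q⊔p V₀ b)

  mix-⊔ˡ : ∀ b → V₀ ≤ mix p V₀ (V₀ ⊔ b)
  mix-⊔ˡ b = subst (_≤ mix p V₀ (V₀ ⊔ b)) (mix-idem p V₀) (mix-mono 0≤p p≤1 ≤-refl (p≤p⊔q V₀ b))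

  -- Accepting the item when it is active and gaining nothing else already yields `p`. This is what
  -- pays for a rejection.
  p≤mix-⊔ : 0ℚ ≤ V₀ → ∀ {V₁} → 0ℚ ≤ V₁ → p ≤ mix p V₀ (V₀ ⊔ (1ℚ + V₁))
  p≤mix-⊔ 0≤V₀ {V₁} 0≤V₁ = begin
    p                          ≡⟨ solve 1 (λ p → p := (con 1ℚ :- p) :* con 0ℚ :+ p :* con 1ℚ) refl p ⟩
    mix p 0ℚ 1ℚ                ≤⟨ mix-mono 0≤p p≤1 0≤V₀ (p≤q+r 0≤V₁) ⟩
    mix p V₀ (1ℚ + V₁)         ≤⟨ mix-⊔ʳ (1ℚ + V₁) ⟩
    mix p V₀ (V₀ ⊔ (1ℚ + V₁))  ∎
    where
    open ≤-Reasoning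
    p≤q+r : ∀ {q r} → 0ℚ ≤ r → q ≤ q + r
    p≤q+r 0≤r = p≤q⇒p≤q+r 0≤r ≤-refl

-- Here y is Φ(F \ 0) / 2 ^ k, κ is k, and V₀, V₁, V are the online values of F \ 0, F / 0, F.
module _ {κ y p c ε V₀ V : ℚ} (V₀-bound : κ + y ≤ 1ℚ + c * V₀) (0≤c : 0ℚ ≤ c) where

  -- The increase `ε` occurs only with probability `p`, and `p ≤ V` turns the expected loss into an
  -- increase of the rate by `ε`.
  reject-step : 0ℚ ≤ ε → V₀ ≤ V → p ≤ V → κ + mix p y (y + ε) ≤ 1ℚ + (c + ε) * V
  reject-step 0≤ε V₀≤V p≤V = begin
    κ + mix p y (y + ε)          ≡⟨ solve 4 (λ κ y p ε → κ :+ ((con 1ℚ :- p) :* y :+ p :* (y :+ ε))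
                                      := κ :+ y :+ ε :* p) refl κ y p ε ⟩
    κ + y + ε * p                ≤⟨ +-mono-≤ V₀-bound (*-monoˡ 0≤ε p≤V) ⟩
    1ℚ + c * V₀ + ε * V          ≤⟨ +-monoˡ-≤ (ε * V) (+-monoʳ-≤ 1ℚ (*-monoˡ 0≤c V₀≤V)) ⟩
    1ℚ + c * V + ε * V           ≡⟨ solve 3 (λ c ε V → con 1ℚ :+ c :* V :+ ε :* V
                                      := con 1ℚ :+ (c :+ ε) :* V) refl c ε V ⟩
    1ℚ + (c + ε) * V             ∎
    where open ≤-Reasoning

  -- Averaging the two affine bounds gives the rate `c`; the slack `ε * V` only aligns this case
  -- with `reject-step`.
  accept-step : ∀ {V₁} → 0ℚ ≤ p → p ≤ 1ℚ → 0ℚ ≤ ε * V → κ + (y + y) ≤ 1ℚ + c * (1ℚ + V₁) →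
    mix p V₀ (1ℚ + V₁) ≤ V → κ + mix p y (y + y) ≤ 1ℚ + (c + ε) * V
  accept-step {V₁} 0≤p p≤1 0≤εV V₁-bound mix≤V = begin
    κ + mix p y (y + y)                             ≡⟨ solve 3 (λ κ y p → κ :+ ((con 1ℚ :- p) :* y :+ p :* (y :+ y))
                                                         := (con 1ℚ :- p) :* (κ :+ y) :+ p :* (κ :+ (y :+ y))) refl κ y p ⟩
    mix p (κ + y) (κ + (y + y))                     ≤⟨ mix-mono 0≤p p≤1 V₀-bound V₁-bound ⟩
    mix p (1ℚ + c * V₀) (1ℚ + c * (1ℚ + V₁))        ≡⟨ solve 4 (λ p c V₀ V₁ →
                                                         (con 1ℚ :- p) :* (con 1ℚ :+ c :* V₀) :+ p :* (con 1ℚ :+ c :* (con 1ℚ :+ V₁))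
                                                         := con 1ℚ :+ c :* ((con 1ℚ :- p) :* V₀ :+ p :* (con 1ℚ :+ V₁))) refl p c V₀ V₁ ⟩
    1ℚ + c * mix p V₀ (1ℚ + V₁)                     ≤⟨ +-monoʳ-≤ 1ℚ (*-monoˡ 0≤c mix≤V) ⟩
    1ℚ + c * V                                      ≤⟨ p≤q⇒p≤q+r 0≤εV ≤-refl ⟩
    1ℚ + c * V + ε * V                              ≡⟨ solve 3 (λ c ε V → con 1ℚ :+ c :* V :+ ε :* V
                                                         := con 1ℚ :+ (c :+ ε) :* V) refl c ε V ⟩
    1ℚ + (c + ε) * V                                ∎
    where open ≤-Reasoning

-- Since `y + y` is at most 4 and `level` gives κ ≤ 1 + μ + c V₁, the excess over 1 + c V₁ is at
-- most 4 + μ. The unit gained by accepting is worth `c`, which covers it.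
accepted-bound : ∀ {κ y μ c V₁} → y ≤ 2ℚ → 1ℚ + κ ≤ 1ℚ + μ + (1ℚ + c * V₁) → toℚ 4 + μ ≤ c →
  κ + (y + y) ≤ 1ℚ + c * (1ℚ + V₁)
accepted-bound {κ} {y} {μ} {c} {V₁} y≤2 level 4+μ≤c = begin
  κ + (y + y)                                   ≤⟨ +-monoʳ-≤ κ (+-mono-≤ y≤2 y≤2) ⟩
  κ + (2ℚ + 2ℚ)                                 ≡⟨ solve 1 (λ κ → κ :+ (con 2ℚ :+ con 2ℚ) := con 1ℚ :+ κ :+ con (toℚ 3)) refl κ ⟩
  1ℚ + κ + toℚ 3                                ≤⟨ +-monoˡ-≤ (toℚ 3) level ⟩
  1ℚ + μ + (1ℚ + c * V₁) + toℚ 3                ≡⟨ solve 2 (λ μ z → con 1ℚ :+ μ :+ (con 1ℚ :+ z) :+ con (toℚ 3)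
                                                     := con 1ℚ :+ ((con (toℚ 4) :+ μ) :+ z)) refl μ (c * V₁) ⟩
  1ℚ + (toℚ 4 + μ + c * V₁)                     ≤⟨ +-monoʳ-≤ 1ℚ (+-monoˡ-≤ (c * V₁) 4+μ≤c) ⟩
  1ℚ + (c + c * V₁)                             ≡⟨ solve 2 (λ c V₁ → con 1ℚ :+ (c :+ c :* V₁) := con 1ℚ :+ c :* (con 1ℚ :+ V₁)) refl c V₁ ⟩
  1ℚ + c * (1ℚ + V₁)                            ∎
  where open ≤-Reasoning

-- The induction over the items.

-- `toℚ 4 + toℚ m` is the price of a unit gained in the accepting case, and each of the `n` items
-- adds an error ε = `½^ m` for a possible rejection.
rate : ℕ → ℕ → ℚ
rate m n = toℚ 4 + toℚ m + toℚ n * ½^ m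

rate-suc : ∀ m n → rate m (suc n) ≡ rate m n + ½^ m
rate-suc m n = trans (cong (λ ν → toℚ 4 + toℚ m + ν * ½^ m) (toℚ-+ 1 n))
  (solve 3 (λ a ν t → a :+ (con 1ℚ :+ ν) :* t := a :+ ν :* t :+ t) refl (toℚ 4 + toℚ m) (toℚ n) (½^ m))

4+m≤rate : ∀ m n → toℚ 4 + toℚ m ≤ rate m n
4+m≤rate m n = p≤q⇒p≤q+r (*-nonNeg (toℚ-nonNeg n) (½^-nonNeg m)) ≤-refl

rate-nonNeg : ∀ m n → 0ℚ ≤ rate m n
rate-nonNeg m n = ≤-trans (p≤q⇒p≤q+r (toℚ-nonNeg m) (toℚ-nonNeg 4)) (4+m≤rate m n)

mix-scale : ∀ p a b t → mix p a b * t ≡ mix p (a * t) (b * t)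
mix-scale = solve 4 (λ p a b t → ((con 1ℚ :- p) :* a :+ p :* b) :* t
  := (con 1ℚ :- p) :* (a :* t) :+ p :* (b :* t)) refl

-- The exponent `k` of the deletion is reused for `F`. The scaled potential at most doubles, so
-- `logBound-normalise` can restore the bound 2 on it.
logBound-step : ∀ m {n} {F : Family (suc n)} → DownwardClosed F →
  ∀ p ps → 0ℚ ≤ p → p ≤ 1ℚ → ValidProbs ps →
  LogBound (potential (F ▹ outside) ps) (rate m n * onlineValue (F ▹ outside) ps) →
  LogBound (potential (F ▹ inside) ps) (rate m n * onlineValue (F ▹ inside) ps) →
  LogBound (potential F (p ∷ ps)) (rate m (suc n) * onlineValue F (p ∷ ps))
logBound-step m {n} {F} dc p ps 0≤p p≤1 vs (k , y≤2 , V₀-bound) bound₁ =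
  logBound-normalise {Φ} {rate m (suc n) * onlineValue F (p ∷ ps)} k
    (begin
      Φ * t                      ≤⟨ scaled (active-≤-double dc ps vs) ⟩
      mix p y ((Φ₀ + Φ₀) * t)    ≡⟨ cong (mix p y) (*-distribʳ-+ t Φ₀ Φ₀) ⟩
      mix p y (y + y)            ≤⟨ mix-mono 0≤p p≤1 (p≤q⇒p≤q+r (toℚ-nonNeg 2) y≤2) (+-mono-≤ y≤2 y≤2) ⟩
      mix p (2ℚ + 2ℚ) (2ℚ + 2ℚ)  ≡⟨ mix-idem p (2ℚ + 2ℚ) ⟩
      2ℚ + 2ℚ                    ∎)
    (subst (λ r → toℚ k + Φ * t ≤ 1ℚ + r * onlineValue F (p ∷ ps)) (sym (rate-suc m n)) (step (F (inside ∷ ⊥)) refl))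
  where
  open ≤-Reasoning
  t = ½^ k
  ε = ½^ m
  c = rate m n
  Φ = potential F (p ∷ ps)
  Φ₀ = potential (F ▹ outside) ps
  Φ₁ = potential (F ▹ inside) ps
  V₀ = onlineValue (F ▹ outside) ps
  V₁ = onlineValue (F ▹ inside) ps
  y = Φ₀ * t

  0≤V₀ : 0ℚ ≤ V₀
  0≤V₀ = onlineValue-nonNeg (F ▹ outside) ps vs

  0≤V₁ : 0ℚ ≤ V₁
  0≤V₁ = onlineValue-nonNeg (F ▹ inside) ps vs

  scaled : ∀ {a} → 𝔼 ps (λ x → toℚ (2 ℕ.^ opt F (true ∷ x))) ≤ a → Φ * t ≤ mix p y (a * t)
  scaled {a} Φ⁺≤a = ≤-trans (*-monoʳ (½^-nonNeg k) (potential-step dc ps vs 0≤p p≤1 Φ⁺≤a))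
    (≤-reflexive (mix-scale p Φ₀ a t))

  skip : F (inside ∷ ⊥) ≡ false → toℚ k + Φ * t ≤ 1ℚ + (c + ε) * mix p V₀ V₀
  skip F⁅0⁆ = begin
    toℚ k + Φ * t                  ≤⟨ +-monoʳ-≤ (toℚ k) (scaled (active-≤-skip dc ps vs F⁅0⁆)) ⟩
    toℚ k + mix p y y              ≡⟨ cong (λ z → toℚ k + z) (mix-idem p y) ⟩
    toℚ k + y                      ≤⟨ V₀-bound ⟩
    1ℚ + c * V₀                    ≤⟨ +-monoʳ-≤ 1ℚ (*-monoʳ {V₀} {c} {c + ε} 0≤V₀ (p≤q⇒p≤q+r (½^-nonNeg m) ≤-refl)) ⟩
    1ℚ + (c + ε) * V₀              ≡⟨ cong (λ v → 1ℚ + (c + ε) * v) (mix-idem p V₀) ⟨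
    1ℚ + (c + ε) * mix p V₀ V₀     ∎

  -- The share of the contraction in the scaled potential is compared with `ε`. Below the threshold
  -- the loss is charged to `p`; above it, `logBound-level` ties `k` to the bound for the
  -- contraction.
  choose : Φ₁ * 2ℚ * t ≤ ε ⊎ ε ≤ Φ₁ * 2ℚ * t → toℚ k + Φ * t ≤ 1ℚ + (c + ε) * mix p V₀ (V₀ ⊔ (1ℚ + V₁))
  choose (inj₁ small) = begin
    toℚ k + Φ * t                              ≤⟨ +-monoʳ-≤ (toℚ k) (scaled (active-≤-choice dc ps vs)) ⟩
    toℚ k + mix p y ((Φ₀ + Φ₁ * 2ℚ) * t)       ≡⟨ cong (λ z → toℚ k + mix p y z) (*-distribʳ-+ t Φ₀ (Φ₁ * 2ℚ)) ⟩
    toℚ k + mix p y (y + Φ₁ * 2ℚ * t)          ≤⟨ +-monoʳ-≤ (toℚ k) (mix-mono 0≤p p≤1 ≤-refl (+-monoʳ-≤ y small)) ⟩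
    toℚ k + mix p y (y + ε)                    ≤⟨ reject-step {toℚ k} {y} {p} {c} {ε} {V₀} V₀-bound (rate-nonNeg m n) (½^-nonNeg m)
                                                    (mix-⊔ˡ 0≤p p≤1 (1ℚ + V₁)) (p≤mix-⊔ 0≤p p≤1 0≤V₀ {V₁} 0≤V₁) ⟩
    1ℚ + (c + ε) * mix p V₀ (V₀ ⊔ (1ℚ + V₁))   ∎
  choose (inj₂ large) = begin
    toℚ k + Φ * t                              ≤⟨ +-monoʳ-≤ (toℚ k) (scaled (active-≤-double dc ps vs)) ⟩
    toℚ k + mix p y ((Φ₀ + Φ₀) * t)            ≡⟨ cong (λ z → toℚ k + mix p y z) (*-distribʳ-+ t Φ₀ Φ₀) ⟩
    toℚ k + mix p y (y + y)                    ≤⟨ accept-step {toℚ k} {y} {p} {c} {ε} {V₀} V₀-bound (rate-nonNeg m n) {V₁} 0≤p p≤1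
                                                    (*-nonNeg (½^-nonNeg m) (≤-trans 0≤V₀ (mix-⊔ˡ 0≤p p≤1 (1ℚ + V₁))))
                                                    (accepted-bound {toℚ k} {y} {toℚ m} {c} {V₁} y≤2
                                                      (subst₂ (λ a b → a ≤ b + (1ℚ + c * V₁)) (toℚ-+ 1 k) (toℚ-+ 1 m)
                                                        (logBound-level {Φ₁} {c * V₁} k m large bound₁))
                                                      (4+m≤rate m n))
                                                    (mix-⊔ʳ 0≤p p≤1 (1ℚ + V₁)) ⟩
    1ℚ + (c + ε) * mix p V₀ (V₀ ⊔ (1ℚ + V₁))   ∎

  -- The feasibility bit is abstracted with its equation so that the conditional inside
  -- `onlineValue` reduces.
  step : ∀ feasible → F (inside ∷ ⊥) ≡ feasible →
    toℚ k + Φ * t ≤ 1ℚ + (c + ε) * mix p V₀ (if feasible then V₀ ⊔ (1ℚ + V₁) else V₀)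
  step false F⁅0⁆ = skip F⁅0⁆
  step true  F⁅0⁆ = choose (≤-total (Φ₁ * 2ℚ * t) ε)

potential-logBound : ∀ m {n} {F : Family n} → DownwardClosed F → (ps : Vec ℚ n) → ValidProbs ps →
  LogBound (potential F ps) (rate m n * onlineValue F ps)
potential-logBound m {F = F} dc [] _ =
  -- Without items the optimum is 0 and the potential at most 1, whose logarithm 0 is attained at
  -- `k = 0`.
  0 , ≤-trans Φ≤1 (toℚ-mono {1} {2} (ℕ.s≤s ℕ.z≤n)) ,
  (begin
    0ℚ + toℚ (2 ℕ.^ opt F []) * 1ℚ    ≡⟨ +-identityˡ _ ⟩
    toℚ (2 ℕ.^ opt F []) * 1ℚ         ≤⟨ Φ≤1 ⟩
    1ℚ                                ≡⟨ trans (cong (λ z → 1ℚ + z) (*-zeroʳ (rate m 0))) (+-identityʳ 1ℚ) ⟨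
    1ℚ + rate m 0 * 0ℚ                ∎)
  where
  open ≤-Reasoning
  Φ≤1 : toℚ (2 ℕ.^ opt F []) * 1ℚ ≤ 1ℚ
  Φ≤1 = ≤-trans (≤-reflexive (*-identityʳ (toℚ (2 ℕ.^ opt F []))))
    (toℚ-2^-mono (opt-least F [] {0} (λ { [] _ → ℕ.z≤n })))
potential-logBound m dc (p ∷ ps) (0≤p , p≤1 , vs) = logBound-step m dc p ps 0≤p p≤1 vs
  (potential-logBound m (▹-downwardClosed dc outside) ps vs)
  (potential-logBound m (▹-downwardClosed dc inside) ps vs)

-- From the potential to the expected optimum.

-- Jensen's inequality with an explicit supporting line: the chord at the witness `k` bounds the
-- optimum of every outcome, and its average is the given bound.
𝔼-opt-≤-logBound : ∀ {n} {F : Family n} ps → ValidProbs ps → ∀ {R} →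
  LogBound (potential F ps) R → 𝔼 ps (toℚ ∘ opt F) ≤ R
𝔼-opt-≤-logBound {F = F} ps vs {R} (k , _ , bound) = +-cancelˡ-≤ 1ℚ (begin
  1ℚ + 𝔼 ps (toℚ ∘ opt F)                               ≡⟨ 𝔼-shift ps 1ℚ (toℚ ∘ opt F) ⟨
  𝔼 ps (λ x → 1ℚ + toℚ (opt F x))                       ≡⟨ 𝔼-cong ps (λ x → toℚ-+ 1 (opt F x)) ⟨
  𝔼 ps (λ x → toℚ (suc (opt F x)))                      ≤⟨ 𝔼-mono ps vs (λ x → tangent-≤-2^ (opt F x) k) ⟩
  𝔼 ps (λ x → toℚ k + toℚ (2 ℕ.^ opt F x) * ½^ k)       ≡⟨ 𝔼-shift ps (toℚ k) _ ⟩
  toℚ k + 𝔼 ps (λ x → toℚ (2 ℕ.^ opt F x) * ½^ k)       ≡⟨ cong (λ z → toℚ k + z) (𝔼-scale ps _ (½^ k)) ⟩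
  toℚ k + potential F ps * ½^ k                         ≤⟨ bound ⟩
  1ℚ + R                      ∎)
  where
  open ≤-Reasoning
  +-cancelˡ-≤ : ∀ r {p q} → r + p ≤ r + q → p ≤ q
  +-cancelˡ-≤ r {p} {q} r+p≤r+q = subst₂ _≤_ (cancel p) (cancel q) (+-monoʳ-≤ (- r) r+p≤r+q)
    where
    cancel : ∀ p → - r + (r + p) ≡ p
    cancel p = trans (sym (+-assoc (- r) r p)) (trans (cong (_+ p) (+-inverseˡ r)) (+-identityˡ p))

𝔼-opt-≤ : ∀ m {n} {F : Family n} → DownwardClosed F → (ps : Vec ℚ n) → ValidProbs ps →
  𝔼 ps (toℚ ∘ opt F) ≤ rate m n * onlineValue F ps
𝔼-opt-≤ m dc ps vs = 𝔼-opt-≤-logBound ps vs (potential-logBound m dc ps vs)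

-- The logarithmic rate.

n<2^suc⌊log₂n⌋ : ∀ n → n ℕ.< 2 ℕ.^ suc ⌊log₂ n ⌋
n<2^suc⌊log₂n⌋ n = ℕₚ.≰⇒> λ 2^≤n →
  ℕₚ.1+n≰n (subst (ℕ._≤ ⌊log₂ n ⌋) (⌊log₂[2^n]⌋≡n (suc ⌊log₂ n ⌋)) (⌊log₂⌋-mono-≤ 2^≤n))

-- With `m = suc ⌊log₂ n ⌋` the `n` rejection errors sum to at most 1. As `m` is at least 1, the
-- total 4 + m + 1 is at most 6 m, which is the source of the constant 6.
rate-log : ∀ n → rate (suc ⌊log₂ n ⌋) n ≤ toℚ (6 ℕ.* suc ⌊log₂ n ⌋)
rate-log n = begin
  toℚ 4 + toℚ m + toℚ n * ½^ m              ≤⟨ +-monoʳ-≤ (toℚ 4 + toℚ m) (*-monoʳ (½^-nonNeg m) (toℚ-mono (ℕₚ.<⇒≤ (n<2^suc⌊log₂n⌋ n)))) ⟩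
  toℚ 4 + toℚ m + toℚ (2 ℕ.^ m) * ½^ m      ≡⟨ cong₂ _+_ (sym (toℚ-+ 4 m)) (2^*½^≡1 m) ⟩
  toℚ (4 ℕ.+ m) + toℚ 1                     ≡⟨ toℚ-+ (4 ℕ.+ m) 1 ⟨
  toℚ (4 ℕ.+ m ℕ.+ 1)                       ≤⟨ toℚ-mono 4+m+1≤6m ⟩
  toℚ (6 ℕ.* m)                             ∎
  where
  open ≤-Reasoning
  m = suc ⌊log₂ n ⌋
  4+m+1≤6m : 4 ℕ.+ m ℕ.+ 1 ℕ.≤ 6 ℕ.* m
  4+m+1≤6m = subst₂ ℕ._≤_ (trans (ℕₚ.+-comm m 5) (cong (4 ℕ.+_) (ℕₚ.+-comm 1 m))) refl
    (ℕₚ.+-monoʳ-≤ m (ℕₚ.m≤m*n 5 m))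

theorem2p2 : Σ[ C ∈ ℕ ] Σ[ alg ∈ Algorithm ]
    ((n : ℕ) (F : Family n) → DownwardClosed F → (p : Vec ℚ n) → ValidProbs p →
    expect p (opt F) ≤ toℚ (C ℕ.* suc ⌊log₂ n ⌋) * expect p (λ x → value x (run F (alg n F p) x)))
theorem2p2 = 6 , (λ n → optimal {n}) , λ n F dc p vs → begin
  expect p (opt F)                                              ≡⟨ expect≡𝔼 p (opt F) ⟩
  𝔼 p (toℚ ∘ opt F)                                             ≤⟨ 𝔼-opt-≤ (suc ⌊log₂ n ⌋) dc p vs ⟩
  rate (suc ⌊log₂ n ⌋) n * onlineValue F p                      ≤⟨ *-monoʳ (onlineValue-nonNeg F p vs) (rate-log n) ⟩
  toℚ (6 ℕ.* suc ⌊log₂ n ⌋) * onlineValue F p                   ≡⟨ cong (toℚ (6 ℕ.* suc ⌊log₂ n ⌋) *_)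
                                                                     (trans (expect≡𝔼 p (λ x → value x (run F (optimal F p) x)))
                                                                            (strategyValue≡onlineValue F p)) ⟨
  toℚ (6 ℕ.* suc ⌊log₂ n ⌋) * expect p (λ x → value x (run F (optimal F p) x)) ∎
  where open ≤-Reasoning
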